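{- Let $E$ be an orthocomplete homogeneous effect algebra. Then every block of $E$ is a lattice.
   Context: An effect algebra is a partial algebra $(E;\oplus,0,1)$ with $0\neq 1$ and a partial binary operation $\oplus$ such that for all $x,y,z\in E$: (1) $x\oplus y=y\oplus x$ if $x\oplus y$ is defined; (2) $(x\oplus y)\oplus z=x\oplus(y\oplus z)$ if one side is defined; (3) for every $x$ there is a unique $y$ (denoted $x'$) with $x\oplus y=1$; (4) if $1\oplus x$ is defined then $x=0$. One writes $x\le y$ and $y\ominus x=z$ iff $x\oplus z$ is defined and equals $y$; $\le$ is a partial order. A sub-effect algebra of $E$ is a subset $Q\subseteq E$ with $1\in Q$ such that whenever $x\oplus y=z$ in $E$ and two of $x,y,z$ lie in $Q$, all three lie in $Q$; it is an effect algebra with the inherited operation. $E$ satisfies the Riesz decomposition property if $u\le v_1\oplus v_2$ implies $u=u_1\oplus u_2$ for some $u_1\le v_1$, $u_2\le v_2$. $E$ is homogeneous if $u\le v_1\oplus v_2\le u'$ implies $u=u_1\oplus u_2$ for some $u_1\le v_1$, $u_2\le v_2$. A block of a homogeneous effect algebra $E$ is a maximal sub-effect algebra of $E$ with the Riesz decomposition property. A system $G=(x_\kappa)_{\kappa\in H}$ of not necessarily different elements of $E$ is orthogonal if for every finite subsystem $K$ of $G$ the sum $\bigoplus K$ exists (with $\bigoplus\emptyset=0$); it is orthosummable if the supremum $\bigvee\{\bigoplus K\mid K\subseteq G\text{ finite}\}$ exists in $E$. $E$ is orthocomplete if every orthogonal system in $E$ is orthosummable. -}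

module Defs where

open import Level using (Level; _⊔_) renaming (suc to lsuc)
open import Data.Irrelevant using ([_])
open import Data.List.Base using (List; []; _∷_)
open import Data.List.Relation.Unary.Unique.Propositional using (Unique)
open import Data.Product using (∃; ∃₂; ∃!; _×_; _,_; proj₁)
open import Data.Sum.Base using (_⊎_)
open import Data.Refinement.Base using (Refinement; value; _,_)
open import Relation.Binary.Bundles using (Poset)
open import Relation.Binary.Lattice.Structures using (IsLattice)
open import Relation.Binary.PropositionalEquality.Core using (_≡_; _≢_; refl; cong; subst)
open import Relation.Unary using (Pred; _∈_; _⊆_)

private
  variable
    c ℓ q : Level

-- Together with excluded middle this stands for the ambient ZFC.  The chain
-- may be empty, so the poset need not be assumed inhabited.
ZornsLemma : ∀ c ℓ₁ ℓ₂ → Set (lsuc (c ⊔ ℓ₁ ⊔ ℓ₂))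
ZornsLemma c ℓ₁ ℓ₂ = (P : Poset c ℓ₁ ℓ₂) →
  let open Poset P in
  ((C : Pred Carrier c) → (∀ {x y} → x ∈ C → y ∈ C → x ≤ y ⊎ y ≤ x) →
    ∃ λ u → ∀ {x} → x ∈ C → x ≤ u) →
  ∃ λ m → ∀ {x} → m ≤ x → x ≈ m

-- The partial operation is given by its graph: x ⊕ y ↦ z says that x ⊕ y is
-- defined and equal to z.
record EffectAlgebra c ℓ : Set (lsuc (c ⊔ ℓ)) where
  infix 4 _⊕_↦_ _≤_
  field
    Carrier : Set c
    _⊕_↦_   : Carrier → Carrier → Carrier → Set ℓ
    0#      : Carrier
    1#      : Carrier
    functional     : ∀ {x y z w} → x ⊕ y ↦ z → x ⊕ y ↦ w → z ≡ w
    0≢1            : 0# ≢ 1#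
    comm           : ∀ {x y z} → x ⊕ y ↦ z → y ⊕ x ↦ z
    assocʳ         : ∀ {x y z u w} → x ⊕ y ↦ u → u ⊕ z ↦ w →
                     ∃ λ v → y ⊕ z ↦ v × x ⊕ v ↦ w
    assocˡ         : ∀ {x y z v w} → y ⊕ z ↦ v → x ⊕ v ↦ w →
                     ∃ λ u → x ⊕ y ↦ u × u ⊕ z ↦ w
    orthosupplement : ∀ x → ∃! _≡_ λ y → x ⊕ y ↦ 1#
    zero-one       : ∀ {x z} → 1# ⊕ x ↦ z → x ≡ 0#

  _′ : Carrier → Carrier
  x ′ = proj₁ (orthosupplement x)

  _≤_ : Carrier → Carrier → Set (c ⊔ ℓ)
  x ≤ y = ∃ λ z → x ⊕ z ↦ y

  1⊕0↦1 : 1# ⊕ 0# ↦ 1#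
  1⊕0↦1 with orthosupplement 1#
  ... | y , 1⊕y↦1 , _ = subst (λ t → 1# ⊕ t ↦ 1#) (zero-one 1⊕y↦1) 1⊕y↦1

module _ (E : EffectAlgebra c ℓ) where
  open EffectAlgebra E

  record IsSubEffectAlgebra (Q : Pred Carrier q) : Set (c ⊔ ℓ ⊔ q) where
    field
      1∈   : 1# ∈ Q
      xy⇒z : ∀ {x y z} → x ⊕ y ↦ z → x ∈ Q → y ∈ Q → z ∈ Q
      xz⇒y : ∀ {x y z} → x ⊕ y ↦ z → x ∈ Q → z ∈ Q → y ∈ Q
      yz⇒x : ∀ {x y z} → x ⊕ y ↦ z → y ∈ Q → z ∈ Q → x ∈ Q

  -- A refinement type makes membership proofs irrelevant, so that elements of
  -- the subalgebra are equal as soon as their underlying elements are.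
  subEffectAlgebra : (Q : Pred Carrier q) → IsSubEffectAlgebra Q →
                     EffectAlgebra (c ⊔ q) ℓ
  subEffectAlgebra Q sub = record
    { Carrier         = Refinement Carrier Q
    ; _⊕_↦_           = λ x y z → value x ⊕ value y ↦ value z
    ; 0#              = 0# , [ xz⇒y 1⊕0↦1 1∈ 1∈ ]
    ; 1#              = 1# , [ 1∈ ]
    ; functional      = λ s t → ≡-lift (functional s t)
    ; 0≢1             = λ eq → 0≢1 (cong value eq)
    ; comm            = comm
    ; assocʳ          = λ { {_} {_ , [ y∈ ]} {_ , [ z∈ ]} s t →
        let v , p , r = assocʳ s t in (v , [ xy⇒z p y∈ z∈ ]) , p , r }
    ; assocˡ          = λ { {_ , [ x∈ ]} {_ , [ y∈ ]} s t →
        let u , p , r = assocˡ s t in (u , [ xy⇒z p x∈ y∈ ]) , p , r }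
    ; orthosupplement = λ { (x , [ x∈ ]) →
        let y , p , unique = orthosupplement x in
        (y , [ xz⇒y p x∈ 1∈ ]) , p , λ r → ≡-lift (unique r) }
    ; zero-one        = λ s → ≡-lift (zero-one s)
    }
    where
    open IsSubEffectAlgebra sub
    ≡-lift : {x y : Refinement Carrier Q} → value x ≡ value y → x ≡ y
    ≡-lift {_ , _} {_ , _} refl = refl

module _ (E : EffectAlgebra c ℓ) where
  open EffectAlgebra E

  RieszDecomposition : Set (c ⊔ ℓ)
  RieszDecomposition = ∀ {u v₁ v₂ v} → v₁ ⊕ v₂ ↦ v → u ≤ v →
    ∃₂ λ u₁ u₂ → u₁ ≤ v₁ × u₂ ≤ v₂ × u₁ ⊕ u₂ ↦ u

  Homogeneous : Set (c ⊔ ℓ)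
  Homogeneous = ∀ {u v₁ v₂ v} → v₁ ⊕ v₂ ↦ v → u ≤ v → v ≤ u ′ →
    ∃₂ λ u₁ u₂ → u₁ ≤ v₁ × u₂ ≤ v₂ × u₁ ⊕ u₂ ↦ u

  -- Sum x K s says that ⨁ K is defined and equal to s.  By commutativity and
  -- associativity the order of the entries of K does not matter.
  data Sum {H : Set q} (x : H → Carrier) : List H → Carrier → Set (c ⊔ ℓ ⊔ q) where
    []  : Sum x [] 0#
    _∷_ : ∀ {κ K s t} → x κ ⊕ s ↦ t → Sum x K s → Sum x (κ ∷ K) t

  -- Finite subsystems are duplicate-free lists of indices; x itself need not
  -- be injective.
  Orthogonal : {H : Set q} → (H → Carrier) → Set (c ⊔ ℓ ⊔ q)
  Orthogonal x = ∀ K → Unique K → ∃ (Sum x K)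

  FiniteSum : {H : Set q} → (H → Carrier) → Pred Carrier (c ⊔ ℓ ⊔ q)
  FiniteSum x s = ∃ λ K → Unique K × Sum x K s

  IsSupremum : Pred Carrier q → Carrier → Set (c ⊔ ℓ ⊔ q)
  IsSupremum S u = (∀ {s} → s ∈ S → s ≤ u) ×
                   (∀ {w} → (∀ {s} → s ∈ S → s ≤ w) → u ≤ w)

  Orthosummable : {H : Set q} → (H → Carrier) → Set (c ⊔ ℓ ⊔ q)
  Orthosummable x = ∃ (IsSupremum (FiniteSum x))

  -- Quantification over all index sets has to be bounded by a universe; the one
  -- E lives in suffices.  Zero values may be dropped, and countably many copies
  -- of a value have the same finite sums as any larger number of copies, so up
  -- to its set of finite sums every orthogonal system is a subsystem of one
  -- indexed by Carrier × ℕ.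
  Orthocomplete : Set (lsuc (c ⊔ ℓ))
  Orthocomplete = {H : Set (c ⊔ ℓ)} (x : H → Carrier) → Orthogonal x → Orthosummable x

  IsLatticeOrdered : Set (c ⊔ ℓ)
  IsLatticeOrdered = ∃₂ λ _∨_ _∧_ → IsLattice _≡_ _≤_ _∨_ _∧_

module _ (E : EffectAlgebra c ℓ) where
  open EffectAlgebra E

  -- Given excluded middle every predicate on Carrier is equivalent to one in
  -- any chosen universe, so fixing the level of B and Q loses no subsets.
  record IsBlock (B : Pred Carrier (c ⊔ ℓ)) : Set (lsuc (c ⊔ ℓ)) where
    field
      isSub   : IsSubEffectAlgebra E B
      riesz   : RieszDecomposition (subEffectAlgebra E B isSub)
      maximal : (Q : Pred Carrier (c ⊔ ℓ)) (sub : IsSubEffectAlgebra E Q) →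
                RieszDecomposition (subEffectAlgebra E Q sub) → B ⊆ Q → Q ⊆ B

-- Let B be a block.  If b ∈ B, z ≤ b and z ⊥ b, then z ∈ B: cutting such z off
-- from elements of B in all possible ways yields a sub-effect algebra (the hull
-- of B) that contains B and z and, by homogeneity, inherits the Riesz
-- decomposition property, so maximality applies.
--
-- Given x, y ∈ B, a common refinement of x ⊕ x′ = y ⊕ y′ in B gives x = a ⊕ b and
-- y = a ⊕ c with b ⊥ c.  By Zorn's lemma there is a maximal system of elements of
-- E whose finite sums are below b and c; its supremum m exists by
-- orthocompleteness and is a maximal lower bound of b and c in E.  As m ≤ b and
-- m ≤ c ≤ b′, m lies in B, and the Riesz decomposition property of B makes a ⊕ m
-- the infimum of x and y in B.  Suprema follow by orthosupplementation.

module Submission where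

open import Defs
open import Axiom.ExcludedMiddle using (ExcludedMiddle)
open import Level using (Level; _⊔_; Lift; lift; lower)
open import Relation.Unary using (Pred; _∈_; _⊆_)
open import Data.Bool.Base using (Bool; true; false; T; if_then_else_; _∨_)
open import Data.Bool.Properties using (∨-identityʳ; ∨-zeroʳ; ⇔→≡)
open import Data.Fin.Base using (Fin; zero; suc)
import Data.Fin.Properties as Fin
open import Data.Irrelevant using ([_])
open import Data.List.Base using (List; []; _∷_; _++_; map)
open import Data.List.Extrema.Nat using (max; xs≤max)
import Data.List.Membership.Propositional as List
import Data.List.Relation.Binary.Permutation.Propositional as Perm
open import Data.List.Relation.Binary.Permutation.Propositional using (_↭_; ↭-refl; ↭-trans; prep)
open import Data.List.Relation.Unary.All as All using (All; []; _∷_)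
import Data.List.Relation.Unary.All.Properties as All
open import Data.List.Relation.Unary.AllPairs using ([]; _∷_)
open import Data.List.Relation.Unary.Any using (here; there; any?)
open import Data.List.Relation.Unary.Unique.Propositional using (Unique)
open import Data.Maybe using (Maybe; just; nothing; is-just; to-witness-T)
import Data.Maybe as Maybe
open import Data.Nat.Base using (ℕ; zero; suc) renaming (_≤_ to _≤ℕ_)
open import Data.Nat.Properties using (1+n≰n)
open import Data.Product.Base using (∃; ∃₂; _×_; _,_; proj₁; proj₂)
open import Data.Refinement.Base using (value; _,_)
open import Data.Sum.Base using (_⊎_; inj₁; inj₂)
open import Data.Unit.Polymorphic.Base using (⊤)
import Data.Vec.Base as Vec
open import Data.Vec.N-ary using (N-ary; _$ⁿ_)
open import Function.Base using (_∘_; id; case_of_)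
open import Function.Bundles using (mk⇔)
open import Relation.Binary.Bundles using (Poset)
open import Relation.Binary.PropositionalEquality using (_≡_; _≢_; refl; sym; trans; cong; subst; isEquivalence)
open import Relation.Nullary using (yes; no; does; recompute; contradiction)
open import Relation.Nullary.Decidable using (dec-true; dec-false)

private
  variable
    c ℓ i : Level
    n : ℕ

infixl 6 _⊞_
infix 5 _⇒_

-- Rearranging sums: expressions with the same leaves have the same values.

data Expr (n : ℕ) : Set where
  var : Fin n → Expr n
  _⊞_ : Expr n → Expr n → Expr n

record Rearrangement (n : ℕ) : Set where
  constructor _⇒_
  field source target : Expr n

leaves : Expr n → List (Fin n)
leaves (var i) = i ∷ []
leaves (e ⊞ f) = leaves e ++ leaves f

extract : (i : Fin n) (L : List (Fin n)) → Maybe (∃ λ L′ → i ∷ L′ ↭ L)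
extract i []      = nothing
extract i (j ∷ L) with i Fin.≟ j
... | yes refl = just (L , ↭-refl)
... | no  _    = Maybe.map (λ (L′ , p) → j ∷ L′ , ↭-trans (Perm.swap i j ↭-refl) (prep j p)) (extract i L)

permutation? : (K L : List (Fin n)) → Maybe (K ↭ L)
permutation? []      []      = just ↭-refl
permutation? []      (_ ∷ _) = nothing
permutation? (i ∷ K) L with extract i L
... | nothing       = nothing
... | just (L′ , p) = Maybe.map (λ K↭L′ → ↭-trans (prep i K↭L′) p) (permutation? K L′)

-- On concrete expressions this computes to the unit type, so as an implicit argument it is filled
-- in by η.
SameLeaves : Expr n → Expr n → Set
SameLeaves e f = T (is-just (permutation? (leaves e) (leaves f)))

withVariables : ∀ {a} {A : Set a} n → N-ary n (Expr n) A → A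
withVariables n f = f $ⁿ Vec.map var (Vec.allFin n)

-- Cancellation, the neutral element and rearranged sums

module Theory (E : EffectAlgebra c ℓ) where
  open EffectAlgebra E

  -- A nested product rather than a vector, so that η lets Agda infer it from
  -- its entries.
  Env : ℕ → Set c
  Env zero    = ⊤
  Env (suc n) = Carrier × Env n

  _!_ : Env n → Fin n → Carrier
  (x , _) ! zero  = x
  (_ , ρ) ! suc i = ρ ! i

  private
    variable
      b d e f g h p q r s t u v w x y z a : Carrier

  infix 7 _⟨_⟩_
  -- A relation because `⊕` is partial: a derivation contains every intermediate sum, so matching on
  -- a rearranged one yields the sums that it shows to be defined.
  data Val {n} (ρ : Env n) : Expr n → Carrier → Set (c ⊔ ℓ) where
    ·     : ∀ {i} → Val ρ (var i) (ρ ! i)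
    _⟨_⟩_ : ∀ {e₁ e₂} → Val ρ e₁ x → x ⊕ y ↦ z → Val ρ e₂ y → Val ρ (e₁ ⊞ e₂) z

  infix 4 _⊥_
  _⊥_ : Carrier → Carrier → Set (c ⊔ ℓ)
  x ⊥ y = ∃ λ z → x ⊕ y ↦ z

  -- If z′ supplements z, then both y and w are the orthosupplement of z′ ⊕ x.
  cancel : x ⊕ y ↦ z → x ⊕ w ↦ z → y ≡ w
  cancel {x} {y} {z} {w} xy xw
    with z′ , zz′ , _ ← orthosupplement z
    with p , yz′ , xp ← assocʳ xy zz′
    with q , wz′ , xq ← assocʳ xw zz′
    with refl ← trans (sym (proj₂ (proj₂ (orthosupplement x)) xp)) (proj₂ (proj₂ (orthosupplement x)) xq)
    with t , z′x , yt ← assocʳ yz′ (comm xp)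
    with t′ , z′x′ , wt ← assocʳ wz′ (comm xq)
    with refl ← functional z′x z′x′ =
    trans (sym (proj₂ (proj₂ (orthosupplement t)) (comm yt))) (proj₂ (proj₂ (orthosupplement t)) (comm wt))

  ⊕-identityʳ : ∀ x → x ⊕ 0# ↦ x
  ⊕-identityʳ x
    with x′ , xx′ , _ ← orthosupplement x
    with p , x′0 , xp ← assocʳ xx′ 1⊕0↦1
    with refl ← cancel xx′ xp
    with q , x0 , qx′ ← assocˡ (comm x′0) xp
    with refl ← cancel (comm xx′) (comm qx′) = x0

  ⊕-identityˡ : ∀ x → 0# ⊕ x ↦ x
  ⊕-identityˡ x = comm (⊕-identityʳ x)

  module _ {H : Set i} {f : H → Carrier} where

    Sum-++ : ∀ {K L} → Sum E f K x → Sum E f L y → x ⊕ y ↦ z → Sum E f (K ++ L) z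
    Sum-++ []       t xy with refl ← functional xy (⊕-identityˡ _) = t
    Sum-++ (k ∷ s)  t xy with v , sy , kv ← assocʳ k xy = kv ∷ Sum-++ s t sy

    Sum-++⁻ : ∀ K {L} → Sum E f (K ++ L) z →
              ∃₂ λ x y → Sum E f K x × Sum E f L y × x ⊕ y ↦ z
    Sum-++⁻ []      s = _ , _ , [] , s , ⊕-identityˡ _
    Sum-++⁻ (i ∷ K) (k ∷ s)
      with x , y , sx , sy , xy ← Sum-++⁻ K s
      with u , ku , uy ← assocˡ xy k = _ , _ , ku ∷ sx , sy , uy

    Sum-↭ : ∀ {K L} → K ↭ L → Sum E f K x → Sum E f L x
    Sum-↭ Perm.refl          s           = s
    Sum-↭ (prep i K↭L)       (k ∷ s)     = k ∷ Sum-↭ K↭L s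
    Sum-↭ (Perm.swap i j K↭L) (k ∷ l ∷ s)
      with u , ij , us ← assocˡ l k
      with v , is , jv ← assocʳ (comm ij) us = jv ∷ is ∷ Sum-↭ K↭L s
    Sum-↭ (Perm.trans p q)   s           = Sum-↭ q (Sum-↭ p s)

  module _ {n} {ρ : Env n} where

    Val⇒Sum : ∀ {e} → Val ρ e x → Sum E (ρ !_) (leaves e) x
    Val⇒Sum ·            = ⊕-identityʳ _ ∷ []
    Val⇒Sum (l ⟨ xy ⟩ r) = Sum-++ (Val⇒Sum l) (Val⇒Sum r) xy

    Sum⇒Val : (e : Expr n) → Sum E (ρ !_) (leaves e) x → Val ρ e x
    Sum⇒Val (var i) (k ∷ []) with refl ← functional k (⊕-identityʳ _) = ·
    Sum⇒Val (e₁ ⊞ e₂) s with _ , _ , l , r , xy ← Sum-++⁻ (leaves e₁) s =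
      Sum⇒Val e₁ l ⟨ xy ⟩ Sum⇒Val e₂ r

    Val-functional : ∀ {e} → Val ρ e x → Val ρ e y → x ≡ y
    Val-functional · · = refl
    Val-functional (l ⟨ xy ⟩ r) (l′ ⟨ xy′ ⟩ r′)
      with refl ← Val-functional l l′ | refl ← Val-functional r r′ = functional xy xy′

  open Rearrangement

  -- Otherwise with-abstraction normalises the permutations.
  abstract
    rearrange : ∀ {n} {ρ : Env n} (e f : Expr n) → SameLeaves e f → Val ρ e x → Val ρ f x
    rearrange e f same v = Sum⇒Val f (Sum-↭ (to-witness-T _ same) (Val⇒Sum v))

    shuffle : ∀ n {ρ : Env n} (f : N-ary n (Expr n) (Rearrangement n)) → let r = withVariables n f in
              {_ : SameLeaves (source r) (target r)} → Val ρ (source r) x → Val ρ (target r) x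
    shuffle n f {same} = let e ⇒ e′ = withVariables n f in rearrange e e′ same

    -- If e rearranges to e₁ ⊞ e₂, then the values of e₁ and e₂ add up to that of e.
    combine : ∀ n {ρ : Env n} (f : N-ary n (Expr n) (Expr n × Expr n × Expr n)) →
              let e , e₁ , e₂ = withVariables n f in
              {_ : SameLeaves e (e₁ ⊞ e₂)} →
              Val ρ e z → Val ρ e₁ x → Val ρ e₂ y → x ⊕ y ↦ z
    combine n f {same} v l r with withVariables n f
    ... | e , e₁ , e₂ with l′ ⟨ xy ⟩ r′ ← rearrange e (e₁ ⊞ e₂) same v
      with refl ← Val-functional l l′ | refl ← Val-functional r r′ = xy

    residual : ∀ n {ρ : Env n} (f : N-ary n (Expr n) (Expr n × Expr n × Expr n)) →
               let e , e₁ , e₂ = withVariables n f in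
               {_ : SameLeaves e (e₁ ⊞ e₂)} →
               Val ρ e z → Val ρ e₁ x → x ⊕ y ↦ z → Val ρ e₂ y
    residual n f {same} v l xy with withVariables n f
    ... | e , e₁ , e₂ with l′ ⟨ xy′ ⟩ r′ ← rearrange e (e₁ ⊞ e₂) same v
      with refl ← Val-functional l l′
      with refl ← cancel xy xy′ = r′


  -- Order, orthogonality and refinement matrices

  exchange : x ⊕ y ↦ u → z ⊕ w ↦ v → u ⊕ v ↦ t →
             ∃₂ λ p q → x ⊕ z ↦ p × y ⊕ w ↦ q × p ⊕ q ↦ t
  exchange xy zw uv
    with (· ⟨ xz ⟩ ·) ⟨ pq ⟩ (· ⟨ yw ⟩ ·) ←
      shuffle 4 (λ x y z w → (x ⊞ y) ⊞ (z ⊞ w) ⇒ (x ⊞ z) ⊞ (y ⊞ w))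
        ((· ⟨ xy ⟩ ·) ⟨ uv ⟩ (· ⟨ zw ⟩ ·)) = _ , _ , xz , yw , pq

  interchange : x ⊕ y ↦ u → z ⊕ w ↦ v → u ⊕ v ↦ t → x ⊕ z ↦ p → y ⊕ w ↦ q → p ⊕ q ↦ t
  interchange xy zw uv xz yw
    with _ , _ , xz′ , yw′ , pq ← exchange xy zw uv
    with refl ← functional xz xz′ | refl ← functional yw yw′ = pq

  ≤-trans : x ≤ y → y ≤ z → x ≤ z
  ≤-trans (_ , xd) (_ , ye) with _ , _ , xz ← assocʳ xd ye = _ , xz

  ≤-refl : x ≤ x
  ≤-refl = 0# , ⊕-identityʳ _

  ⊥-sym : x ⊥ y → y ⊥ x
  ⊥-sym (_ , xy) = _ , comm xy

  ⊥-antitoneˡ : x ≤ y → y ⊥ z → x ⊥ z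
  ⊥-antitoneˡ (_ , xd) (_ , yz) with _ , dz , xv ← assocʳ xd yz
    with _ , xz , _ ← assocˡ (comm dz) xv = _ , xz

  ⊥-antitone : x ≤ y → z ≤ w → y ⊥ w → x ⊥ z
  ⊥-antitone x≤y z≤w y⊥w = ⊥-antitoneˡ x≤y (⊥-sym (⊥-antitoneˡ z≤w (⊥-sym y⊥w)))

  -- Since `1# ⊕ 0#` is defined, so is `1# ⊕ x`, and `zero-one` applies.
  0-minimal : x ⊕ y ↦ 0# → x ≡ 0#
  0-minimal xy with _ , 1x , _ ← assocˡ xy 1⊕0↦1 = zero-one 1x

  -- A two-by-two refinement with row sums u and r and column sums v and w.
  data Matrix (u r v w : Carrier) : Set (c ⊔ ℓ) where
    matrix : ∀ {u₁ u₂ r₁ r₂} → u₁ ⊕ u₂ ↦ u → r₁ ⊕ r₂ ↦ r →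
             u₁ ⊕ r₁ ↦ v → u₂ ⊕ r₂ ↦ w → Matrix u r v w

  remainders : ∀ {u₁ u₂ r₁ r₂} → u₁ ⊕ u₂ ↦ u → u₁ ⊕ r₁ ↦ v → u₂ ⊕ r₂ ↦ w →
               u ⊕ r ↦ t → v ⊕ w ↦ t → r₁ ⊕ r₂ ↦ r
  remainders u₁u₂ u₁r₁ u₂r₂ ur vw
    with · ⟨ r₁r₂ ⟩ · ← residual 4 (λ u₁ u₂ r₁ r₂ → (u₁ ⊞ r₁) ⊞ (u₂ ⊞ r₂) , u₁ ⊞ u₂ , r₁ ⊞ r₂)
                          ((· ⟨ u₁r₁ ⟩ ·) ⟨ vw ⟩ (· ⟨ u₂r₂ ⟩ ·)) (· ⟨ u₁u₂ ⟩ ·) ur = r₁r₂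

  data MatrixIn {i} (P : Pred Carrier i) (u r v w : Carrier) : Set (c ⊔ ℓ ⊔ i) where
    matrix : ∀ {u₁ u₂ r₁ r₂} → u₁ ⊕ u₂ ↦ u → r₁ ⊕ r₂ ↦ r → u₁ ⊕ r₁ ↦ v → u₂ ⊕ r₂ ↦ w →
             u₁ ∈ P → u₂ ∈ P → r₁ ∈ P → r₂ ∈ P → MatrixIn P u r v w

  -- The Riesz decomposition property of P in terms of elements of E, with relevant membership
  -- proofs in place of a refinement type.
  Refining : ∀ {i} → Pred Carrier i → Set (c ⊔ ℓ ⊔ i)
  Refining P = ∀ {u r v w t} → u ⊕ r ↦ t → v ⊕ w ↦ t →
               u ∈ P → r ∈ P → v ∈ P → w ∈ P → MatrixIn P u r v w
  -- Small a s: s is a finite sum of elements orthogonal to a.  For s ≤ a these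
  -- form an ideal of the interval [0 , a], by Small-down and Small-⊕.
  infixr 5 _∷⟨_⟩_
  data Small (a : Carrier) : Carrier → Set (c ⊔ ℓ) where
    []     : Small a 0#
    _∷⟨_⟩_ : u ⊥ a → u ⊕ s ↦ t → Small a s → Small a t

  Small-antitone : b ≤ a → Small a s → Small b s
  Small-antitone b≤a []                = []
  Small-antitone b≤a (u⊥a ∷⟨ us ⟩ Ns) = ⊥-antitone ≤-refl b≤a u⊥a ∷⟨ us ⟩ Small-antitone b≤a Ns

  Small-⊕ : Small a s → Small a t → s ⊕ t ↦ u → Small a u
  Small-⊕ []               Nt st with refl ← functional st (⊕-identityˡ _) = Nt
  Small-⊕ (u⊥a ∷⟨ us ⟩ Ns) Nt st with _ , s′t , uv ← assocʳ us st = u⊥a ∷⟨ uv ⟩ Small-⊕ Ns Nt s′t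

  -- Homogeneity and the ideal of small elements

  module _ (homogeneous : Homogeneous E) where

    split : u ⊥ t → u ⊕ r ↦ t → v ⊕ w ↦ t → Matrix u r v w
    split {u} (z , ut) ur vw
      -- Homogeneity asks for `t ≤ u ′`: as u ⊕ t = z, the orthosupplement of u is t ⊕ z′.
      with z′ , zz′ , _ ← orthosupplement z
      with _ , tz′ , u⊕ ← assocʳ ut zz′
      with refl ← cancel u⊕ (proj₁ (proj₂ (orthosupplement u)))
      with _ , _ , (_ , u₁r₁) , (_ , u₂r₂) , u₁u₂ ← homogeneous vw (_ , ur) (_ , tz′) =
      matrix u₁u₂ (remainders u₁u₂ u₁r₁ u₂r₂ ur vw) u₁r₁ u₂r₂

    -- The summands of s are orthogonal to a, hence to everything below a, so `split` cuts them
    -- along v ⊕ w one at a time.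
    Small-split : Small a s → s ⊕ r ↦ t → t ≤ a → v ⊕ w ↦ t → Matrix s r v w
    Small-split [] sr t≤a vw with refl ← functional sr (⊕-identityˡ _) =
      matrix (⊕-identityˡ _) vw (⊕-identityˡ _) (⊕-identityˡ _)
    Small-split (u⊥a ∷⟨ us ⟩ Ns) sr t≤a vw
      with _ , sr′ , ut′ ← assocʳ us sr
      with matrix u₁u₂ t₁t₂ u₁t₁ u₂t₂ ← split (⊥-antitone ≤-refl t≤a u⊥a) ut′ vw
      with matrix s₁s₂ r₁r₂ s₁r₁ s₂r₂ ← Small-split Ns sr′ (≤-trans (_ , comm ut′) t≤a) t₁t₂
      with _ , u₁s₁ , v₁ ← assocˡ s₁r₁ u₁t₁
      with _ , u₂s₂ , v₂ ← assocˡ s₂r₂ u₂t₂ =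
      matrix (interchange u₁u₂ s₁s₂ us u₁s₁ u₂s₂) r₁r₂ v₁ v₂

    -- Homogeneity cuts f along the summands of p, and whatever lies below an element orthogonal to
    -- a is orthogonal to a.
    Small-below : f ⊥ p → f ≤ p → Small a p → Small a f
    Small-below f⊥p (_ , fr) [] with refl ← 0-minimal fr = []
    Small-below f⊥p (_ , fr) (u⊥a ∷⟨ us ⟩ Ns)
      with matrix f₁f₂ _ f₁r₁ f₂r₂ ← split f⊥p fr us =
      ⊥-antitoneˡ (_ , f₁r₁) u⊥a ∷⟨ f₁f₂ ⟩
        Small-below (⊥-antitone (_ , comm f₁f₂) (_ , comm us) f⊥p) (_ , f₂r₂) Ns

    -- The case s = 0: f lies below the supplement p ⊕ a′ of e and is orthogonal
    -- to it, so homogeneity splits f between the small p and a′.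
    Small-absorb : Small a s → Small a p → e ⊕ s ↦ d → d ⊕ p ↦ a → f ≤ d → f ⊥ e → Small a f
    Small-absorb {a = a} [] Np ed dp f≤d (z , fe)
      with refl ← functional ed (⊕-identityʳ _)
      with a′ , aa′ , _ ← orthosupplement a | z′ , zz′ , _ ← orthosupplement z
      with _ , pa′ , dg ← assocʳ dp aa′
      with · ⟨ fz′ ⟩ · ← residual 3 (λ f d z′ → (f ⊞ d) ⊞ z′ , d , f ⊞ z′) ((· ⟨ fe ⟩ ·) ⟨ zz′ ⟩ ·) · dg
      with matrix f₁f₂ _ f₁≤p f₂≤a′ ← split (⊥-antitoneˡ f≤d (_ , dg)) fz′ pa′ =
      ⊥-antitoneˡ (_ , f₂≤a′) (_ , comm aa′) ∷⟨ comm f₁f₂ ⟩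
        Small-below (⊥-antitoneˡ (≤-trans (_ , f₁f₂) f≤d) (_ , dp)) (_ , f₁≤p) Np
    Small-absorb (u⊥a ∷⟨ us ⟩ Ns) Np es dp (_ , ft) f⊥e
      with · ⟨ ud ⟩ (· ⟨ es′ ⟩ ·) ← shuffle 3 (λ e u s → e ⊞ (u ⊞ s) ⇒ u ⊞ (e ⊞ s)) (· ⟨ es ⟩ (· ⟨ us ⟩ ·))
      -- Cutting u along d = f ⊕ t, f loses a piece of u, which is orthogonal to a, and its rest
      -- lies below e ⊕ s. The summand u then joins p, so that the total remains a.
      with matrix u₁u₂ f′t′ u₁f′ u₂t′ ← split (⊥-antitone ≤-refl (_ , dp) u⊥a) ud ft
      with _ , up , dp′ ← assocʳ (comm ud) dp =
      ⊥-antitoneˡ (_ , u₁u₂) u⊥a ∷⟨ u₁f′ ⟩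
        Small-absorb Ns (u⊥a ∷⟨ up ⟩ Np) es′ dp′ (_ , f′t′) (⊥-antitoneˡ (_ , comm u₁f′) f⊥e)

    -- With e the complement of s in a, everything below s is orthogonal to e, so `Small-absorb`
    -- applies with p = 0.
    Small-down : Small a s → s ≤ a → f ≤ s → Small a f
    Small-down Ns (_ , se) f≤s =
      Small-absorb Ns [] (comm se) (⊕-identityʳ _) (≤-trans f≤s (_ , se)) (⊥-antitoneˡ f≤s (_ , se))

    -- Three-entry decompositions over a Riesz sub-effect algebra

    module Extension {B : Pred Carrier (c ⊔ ℓ)} (isSub : IsSubEffectAlgebra E B)
                     (refineB : Refining B) where
      open IsSubEffectAlgebra isSub

      -- Part a x y z: along some decomposition of a in B into finitely many
      -- pieces b, there are decompositions b = x_b ⊕ y_b ⊕ z_b with at least two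
      -- of the three summands Small b, and x, y, z are the sums of the x_b, y_b, z_b.
      data Part : Carrier → Carrier → Carrier → Carrier → Set (c ⊔ ℓ) where
        leaf₁ : a ∈ B → y ⊕ z ↦ s → x ⊕ s ↦ a → Small a y → Small a z → Part a x y z
        leaf₂ : a ∈ B → x ⊕ z ↦ s → y ⊕ s ↦ a → Small a x → Small a z → Part a x y z
        leaf₃ : a ∈ B → x ⊕ y ↦ s → z ⊕ s ↦ a → Small a x → Small a y → Part a x y z
        join  : Part a x y z → Part b u v w → a ⊕ b ↦ d →
                x ⊕ u ↦ p → y ⊕ v ↦ q → z ⊕ w ↦ r → Part d p q r

      swap₁₂ : Part a x y z → Part a y x z
      swap₁₂ (leaf₁ a∈ yz xs Ny Nz)   = leaf₂ a∈ yz xs Ny Nz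
      swap₁₂ (leaf₂ a∈ xz ys Nx Nz)   = leaf₁ a∈ xz ys Nx Nz
      swap₁₂ (leaf₃ a∈ xy zs Nx Ny)   = leaf₃ a∈ (comm xy) zs Ny Nx
      swap₁₂ (join P Q ab xu yv zw)   = join (swap₁₂ P) (swap₁₂ Q) ab yv xu zw

      swap₂₃ : Part a x y z → Part a x z y
      swap₂₃ (leaf₁ a∈ yz xs Ny Nz)   = leaf₁ a∈ (comm yz) xs Nz Ny
      swap₂₃ (leaf₂ a∈ xz ys Nx Nz)   = leaf₃ a∈ xz ys Nx Nz
      swap₂₃ (leaf₃ a∈ xy zs Nx Ny)   = leaf₂ a∈ xy zs Nx Ny
      swap₂₃ (join P Q ab xu yv zw)   = join (swap₂₃ P) (swap₂₃ Q) ab xu zw yv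

      Part-∈ : Part a x y z → a ∈ B
      Part-∈ (leaf₁ a∈ _ _ _ _)    = a∈
      Part-∈ (leaf₂ a∈ _ _ _ _)    = a∈
      Part-∈ (leaf₃ a∈ _ _ _ _)    = a∈
      Part-∈ (join P Q ab _ _ _)   = xy⇒z ab (Part-∈ P) (Part-∈ Q)

      total : Part a x y z → ∃ λ h → x ⊕ y ↦ h × h ⊕ z ↦ a
      total (leaf₁ _ yz xs _ _) = assocˡ yz xs
      total (leaf₂ _ xz ys _ _) with _ , yx , ha ← assocˡ xz ys = _ , comm yx , ha
      total (leaf₃ _ xy zs _ _) = _ , xy , comm zs
      total (join P Q ab xu yv zw)
        with h , xy , hz ← total P | k , uv , kw ← total Q
        with _ , _ , hk , zw′ , d ← exchange hz kw ab
        with refl ← functional zw zw′ = _ , interchange xy uv hk xu yv , d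

      data Restriction (b d x y z : Carrier) : Set (c ⊔ ℓ) where
        cut : ∀ {x₁ x₂ y₁ y₂ z₁ z₂} → Part b x₁ y₁ z₁ → Part d x₂ y₂ z₂ →
              x₁ ⊕ x₂ ↦ x → y₁ ⊕ y₂ ↦ y → z₁ ⊕ z₂ ↦ z → Restriction b d x y z

      restrict-swap₁₂ : Restriction b d x y z → Restriction b d y x z
      restrict-swap₁₂ (cut P Q x y z) = cut (swap₁₂ P) (swap₁₂ Q) y x z

      restrict-swap₂₃ : Restriction b d x y z → Restriction b d x z y
      restrict-swap₂₃ (cut P Q x y z) = cut (swap₂₃ P) (swap₂₃ Q) x z y

      part₃ : a ∈ B → y ⊕ z ↦ w → x ⊕ w ↦ a → Small a x → Small a y → Part a x y z
      part₃ a∈ yz xw Nx Ny with _ , xy , sz ← assocˡ yz xw = leaf₃ a∈ xy (comm sz) Nx Ny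

      -- The small entries x and then y are cut along b ⊕ d, and z takes up the rest. The pieces are
      -- small relative to a by `Small-down`, hence relative to b and d.
      restrict-leaf : x ⊕ y ↦ s → z ⊕ s ↦ a → Small a x → Small a y →
                      b ∈ B → d ∈ B → b ⊕ d ↦ a → Restriction b d x y z
      restrict-leaf xy zs Nx Ny b∈ d∈ bd
        with _ , yz , xw ← assocʳ xy (comm zs)
        with matrix x₁x₂ w₁w₂ x₁w₁ x₂w₂ ← Small-split Nx xw ≤-refl bd
        with matrix y₁y₂ z₁z₂ y₁z₁ y₂z₂ ← Small-split Ny yz (_ , comm xw) w₁w₂ =
        cut (part₃ b∈ y₁z₁ x₁w₁ (small (_ , bd) Nx (_ , xw) (_ , x₁x₂))
                                (small (_ , bd) Ny y≤a (_ , y₁y₂)))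
            (part₃ d∈ y₂z₂ x₂w₂ (small (_ , comm bd) Nx (_ , xw) (_ , comm x₁x₂))
                                (small (_ , comm bd) Ny y≤a (_ , comm y₁y₂)))
            x₁x₂ y₁y₂ z₁z₂
        where
        y≤a = ≤-trans (_ , comm xy) (_ , comm zs)
        small : ∀ {a e s t} → e ≤ a → Small a s → s ≤ a → t ≤ s → Small e t
        small e≤a Ns s≤a t≤s = Small-antitone e≤a (Small-down Ns s≤a t≤s)

      restrict : Part a x y z → b ∈ B → d ∈ B → b ⊕ d ↦ a → Restriction b d x y z
      restrict (leaf₁ a∈ yz xs Ny Nz) b∈ d∈ bd =
        restrict-swap₁₂ (restrict-swap₂₃ (restrict-leaf yz xs Ny Nz b∈ d∈ bd))
      restrict (leaf₂ a∈ xz ys Nx Nz) b∈ d∈ bd =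
        restrict-swap₂₃ (restrict-leaf xz ys Nx Nz b∈ d∈ bd)
      restrict (leaf₃ a∈ xy zs Nx Ny) b∈ d∈ bd = restrict-leaf xy zs Nx Ny b∈ d∈ bd
      restrict (join P Q ef xu yv zw) b∈ d∈ bd
        -- The Riesz property of B refines e ⊕ f = b ⊕ d inside B; each half of the join is
        -- restricted to its own row.
        with matrix e₁e₂ f₁f₂ e₁f₁ e₂f₂ e₁∈ e₂∈ f₁∈ f₂∈ ← refineB ef bd (Part-∈ P) (Part-∈ Q) b∈ d∈
        with cut P₁ P₂ x₁x₂ y₁y₂ z₁z₂ ← restrict P e₁∈ e₂∈ e₁e₂
        with cut Q₁ Q₂ u₁u₂ v₁v₂ w₁w₂ ← restrict Q f₁∈ f₂∈ f₁f₂
        with _ , _ , x₁u₁ , x₂u₂ , x ← exchange x₁x₂ u₁u₂ xu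
        with _ , _ , y₁v₁ , y₂v₂ , y ← exchange y₁y₂ v₁v₂ yv
        with _ , _ , z₁w₁ , z₂w₂ , z ← exchange z₁z₂ w₁w₂ zw =
        cut (join P₁ Q₁ e₁f₁ x₁u₁ y₁v₁ z₁w₁) (join P₂ Q₂ e₂f₂ x₂u₂ y₂v₂ z₂w₂) x y z

      -- As t ⊥ a, a small y stays small when t is added, and w ≤ z is small if z is, so leaves keep
      -- their kind. At a join, homogeneity cuts t along z.
      move : Part a x y z → t ⊥ a → t ⊕ w ↦ z → ∃ λ u → y ⊕ t ↦ u × Part a x u w
      move (leaf₁ a∈ yz xs Ny Nz) t⊥a tw with _ , yt , uw ← assocˡ tw yz =
        _ , yt , leaf₁ a∈ uw xs (t⊥a ∷⟨ comm yt ⟩ Ny)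
                       (Small-down Nz (≤-trans (_ , comm yz) (_ , comm xs)) (_ , comm tw))
      move (leaf₂ a∈ xz ys Nx Nz) t⊥a tw
        with (· ⟨ yt ⟩ ·) ⟨ us ⟩ (· ⟨ xw ⟩ ·) ←
          shuffle 4 (λ x y t w → y ⊞ (x ⊞ (t ⊞ w)) ⇒ (y ⊞ t) ⊞ (x ⊞ w))
            (· ⟨ ys ⟩ (· ⟨ xz ⟩ (· ⟨ tw ⟩ ·))) =
        _ , yt , leaf₂ a∈ xw us Nx (Small-down Nz (≤-trans (_ , comm xz) (_ , comm ys)) (_ , comm tw))
      move (leaf₃ a∈ xy zs Nx Ny) t⊥a tw
        with · ⟨ ws ⟩ (· ⟨ xu ⟩ (· ⟨ yt ⟩ ·)) ←
          shuffle 4 (λ x y t w → (t ⊞ w) ⊞ (x ⊞ y) ⇒ w ⊞ (x ⊞ (y ⊞ t)))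
            ((· ⟨ tw ⟩ ·) ⟨ zs ⟩ (· ⟨ xy ⟩ ·)) =
        _ , yt , leaf₃ a∈ xu ws Nx (t⊥a ∷⟨ comm yt ⟩ Ny)
      move R@(join P Q ab xu yv zw) t⊥d tw
        with _ , xy , hz ← total R
        with matrix t₁t₂ w₁w₂ t₁w₁ t₂w₂ ← split (⊥-antitone ≤-refl (_ , comm hz) t⊥d) tw zw
        with _ , y₁t₁ , P′ ← move P (⊥-antitone (_ , t₁t₂) (_ , ab) t⊥d) t₁w₁
        with _ , y₂t₂ , Q′ ← move Q (⊥-antitone (_ , comm t₁t₂) (_ , comm ab) t⊥d) t₂w₂
        with (· ⟨ yt ⟩ ·) ⟨ _ ⟩ _ ←
          shuffle 4 (λ x y t w → (x ⊞ y) ⊞ (t ⊞ w) ⇒ (y ⊞ t) ⊞ (x ⊞ w))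
            ((· ⟨ xy ⟩ ·) ⟨ hz ⟩ (· ⟨ tw ⟩ ·)) =
        _ , yt , join P′ Q′ ab xu (interchange yv t₁t₂ yt y₁t₁ y₂t₂) w₁w₂

      -- Enlarging an entry of a decomposition of `1#`

      complement : a ∈ B → ∃ λ b → a ⊕ b ↦ 1# × b ∈ B
      complement {a} a∈ with b , ab , _ ← orthosupplement a = b , ab , xz⇒y ab a∈ 1∈

      -- `move` needs orthogonality to the whole decomposed element, so `1#` is cut into a and its
      -- supplement b. Pieces of u can be moved inside a because u ⊥ a, and inside b because u ≤ a.
      addElement : a ∈ B → Part 1# x y z → u ⊥ a → u ≤ a → u ⊕ w ↦ z →
                   ∃ λ v → y ⊕ u ↦ v × Part 1# x v w
      addElement a∈ R u⊥a (_ , ut) uw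
        with b , ab , b∈ ← complement a∈
        with H , xy , Hz ← total R
        with cut P Q x₁x₂ y₁y₂ z₁z₂ ← restrict R a∈ b∈ ab
        with h , x₁y₁ , hz₁ ← total P
        with matrix u₁u₂ _ u₁h u₂t₂ ← split u⊥a ut hz₁
        with _ , y₁u₂ , P′ ← move P (⊥-antitoneˡ (_ , comm u₁u₂) u⊥a) u₂t₂
        with _ , t₂z₂ , u₂k ← assocʳ u₂t₂ z₁z₂
        with · ⟨ u₁w ⟩ · ← residual 3 (λ u₁ u₂ w → (u₁ ⊞ u₂) ⊞ w , u₂ , u₁ ⊞ w)
                             ((· ⟨ u₁u₂ ⟩ ·) ⟨ uw ⟩ ·) · u₂k
        with _ , _ , x₁y₁′ , _ , hH ← exchange x₁x₂ y₁y₂ xy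
        with refl ← functional x₁y₁ x₁y₁′
        -- u₁ lies below x ⊕ y and also below t₂ ⊕ z₂, which is what is left of z. As x ⊕ y ⊥ z,
        -- homogeneity cuts u₁ between t₂ and z₂.
        with matrix p₁p₂ w₁w₂ p₁w₁ p₂w₂ ←
          split (⊥-antitone (≤-trans (_ , u₁h) (_ , hH)) (_ , comm u₂k) (_ , Hz)) u₁w t₂z₂
        with _ , y₁p₁ , P″ ← move P′ (⊥-antitoneˡ (≤-trans (_ , p₁p₂) (_ , u₁u₂)) u⊥a) p₁w₁
        with _ , y₂p₂ , Q′ ←
          move Q (⊥-antitoneˡ (≤-trans (_ , comm p₁p₂) (≤-trans (_ , u₁u₂) (_ , ut))) (_ , ab)) p₂w₂
        with (· ⟨ yu ⟩ ·) ⟨ _ ⟩ _ ←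
          shuffle 4 (λ x y u w → (x ⊞ y) ⊞ (u ⊞ w) ⇒ (y ⊞ u) ⊞ (x ⊞ w))
            ((· ⟨ xy ⟩ ·) ⟨ Hz ⟩ (· ⟨ uw ⟩ ·)) =
        _ , yu , join P″ Q′ ab x₁x₂
          (combine 5 (λ y₁ y₂ p₁ p₂ u₂ →
              (y₁ ⊞ y₂) ⊞ ((p₁ ⊞ p₂) ⊞ u₂) , (y₁ ⊞ u₂) ⊞ p₁ , y₂ ⊞ p₂)
            ((· ⟨ y₁y₂ ⟩ ·) ⟨ yu ⟩ ((· ⟨ p₁p₂ ⟩ ·) ⟨ u₁u₂ ⟩ ·))
            ((· ⟨ y₁u₂ ⟩ ·) ⟨ y₁p₁ ⟩ ·) (· ⟨ y₂p₂ ⟩ ·))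
          w₁w₂

      addSmall : a ∈ B → Part 1# x y z → Small a s → s ≤ a → s ⊕ w ↦ z →
                 ∃ λ v → y ⊕ s ↦ v × Part 1# x v w
      addSmall a∈ R [] s≤a sw with refl ← functional sw (⊕-identityˡ _) = _ , ⊕-identityʳ _ , R
      addSmall a∈ R (u⊥a ∷⟨ us ⟩ Ns) s≤a sw
        with _ , sw′ , uw′ ← assocʳ us sw
        with _ , yu , R′ ← addElement a∈ R u⊥a (≤-trans (_ , us) s≤a) uw′
        with _ , ys , R″ ← addSmall a∈ R′ Ns (≤-trans (_ , comm us) s≤a) sw′
        with _ , us′ , yv ← assocʳ yu ys
        with refl ← functional us us′ = _ , yv , R″

      -- The part of x ⊕ y inside a is orthogonal to t, hence small by
      -- Small-absorb.  So on a it can be replaced by t and added back afterwards.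
      addCosmall : a ∈ B → Part 1# x y z → Small a s → t ⊕ s ↦ a → t ⊕ w ↦ z →
                   ∃ λ v → y ⊕ t ↦ v × Part 1# x v w
      addCosmall a∈ R Ns ts tw
        with b , ab , b∈ ← complement a∈
        with H , xy , Hz ← total R
        with cut P Q x₁x₂ y₁y₂ z₁z₂ ← restrict R a∈ b∈ ab
        with h , x₁y₁ , hz₁ ← total P | _ , x₂y₂ , kz₂ ← total Q
        with _ , _ , x₁y₁′ , _ , hH ← exchange x₁x₂ y₁y₂ xy
        with refl ← functional x₁y₁ x₁y₁′
        with Nh ← Small-absorb Ns [] ts (⊕-identityʳ _) (_ , hz₁) (⊥-antitone (_ , hH) (_ , tw) (_ , Hz))
        with (· ⟨ x₂t ⟩ (· ⟨ ty₂ ⟩ ·)) ⟨ rest ⟩ (· ⟨ sz₂ ⟩ ·) ←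
          shuffle 5 (λ x₂ y₂ z₂ t s →
              (t ⊞ s) ⊞ ((x₂ ⊞ y₂) ⊞ z₂) ⇒ (x₂ ⊞ (t ⊞ y₂)) ⊞ (s ⊞ z₂))
            ((· ⟨ ts ⟩ ·) ⟨ ab ⟩ ((· ⟨ x₂y₂ ⟩ ·) ⟨ kz₂ ⟩ ·))
        -- Cancelling x₂ ⊕ (t ⊕ y₂) in `1#` identifies the new third entry s ⊕ z₂ with y₁ ⊕ (x₁ ⊕
        -- w), so adding y₁ and x₁ back leaves exactly w.
        with · ⟨ y₁Z ⟩ (· ⟨ x₁w ⟩ ·) ←
          residual 6 (λ x₁ x₂ y₁ y₂ t w →
              ((x₁ ⊞ x₂) ⊞ (y₁ ⊞ y₂)) ⊞ (t ⊞ w) , x₂ ⊞ (t ⊞ y₂) , y₁ ⊞ (x₁ ⊞ w))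
            (((· ⟨ x₁x₂ ⟩ ·) ⟨ xy ⟩ (· ⟨ y₁y₂ ⟩ ·)) ⟨ Hz ⟩ (· ⟨ tw ⟩ ·))
            (· ⟨ x₂t ⟩ (· ⟨ ty₂ ⟩ ·)) rest
        with h≤a ← (_ , hz₁)
        with _ , Yy₁ , R₁ ←
          addSmall a∈ (join (leaf₂ a∈ (⊕-identityˡ _) ts [] Ns) Q ab (⊕-identityˡ _) ty₂ sz₂)
            (Small-down Nh h≤a (_ , comm x₁y₁)) (≤-trans (_ , comm x₁y₁) h≤a) y₁Z
        with _ , x₂x₁ , R₂ ←
          addSmall a∈ (swap₁₂ R₁) (Small-down Nh h≤a (_ , x₁y₁)) (≤-trans (_ , x₁y₁) h≤a) x₁w
        with refl ← functional (comm x₁x₂) x₂x₁ =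
        _ , combine 3 (λ t y₁ y₂ → (t ⊞ y₂) ⊞ y₁ , y₁ ⊞ y₂ , t)
              ((· ⟨ ty₂ ⟩ ·) ⟨ Yy₁ ⟩ ·) (· ⟨ y₁y₂ ⟩ ·) · , swap₁₂ R₂

      -- Leaf by leaf: only in `leaf₁` can t fail to be small, and there its complement in a is
      -- small.
      addPart : Part a t u v → Part 1# x y z → t ⊕ w ↦ z → ∃ λ s → y ⊕ t ↦ s × Part 1# x s w
      addPart (leaf₁ a∈ uv ts Nu Nv) R tw = addCosmall a∈ R (Small-⊕ Nu Nv uv) ts tw
      addPart (leaf₂ a∈ tv us Nt Nv) R tw = addSmall a∈ R Nt (≤-trans (_ , tv) (_ , comm us)) tw
      addPart (leaf₃ a∈ tu vs Nt Nu) R tw = addSmall a∈ R Nt (≤-trans (_ , tu) (_ , comm vs)) tw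
      addPart (join P Q _ t₁t₂ _ _) R tw
        with _ , t₂w , t₁w′ ← assocʳ t₁t₂ tw
        with _ , yt₁ , R₁ ← addPart P R t₁w′
        with _ , yt₂ , R₂ ← addPart Q R₁ t₂w
        with _ , t , yt ← assocʳ yt₁ yt₂
        with refl ← functional t t₁t₂ = _ , yt , R₂

      -- The hull is a sub-effect algebra

      merge : Part a x y z → y ⊕ z ↦ w → Part a x 0# w
      merge (leaf₁ a∈ yz xs Ny Nz) yw with refl ← functional yz yw =
        leaf₁ a∈ (⊕-identityˡ _) xs [] (Small-⊕ Ny Nz yw)
      merge (leaf₂ a∈ xz ys Nx Nz) yw =
        leaf₃ a∈ (⊕-identityʳ _)
          (combine 3 (λ x y z → y ⊞ (x ⊞ z) , y ⊞ z , x) (· ⟨ ys ⟩ (· ⟨ xz ⟩ ·)) (· ⟨ yw ⟩ ·) ·) Nx []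
      merge (leaf₃ a∈ xy zs Nx Ny) yw =
        leaf₃ a∈ (⊕-identityʳ _)
          (combine 3 (λ x y z → z ⊞ (x ⊞ y) , y ⊞ z , x) (· ⟨ zs ⟩ (· ⟨ xy ⟩ ·)) (· ⟨ yw ⟩ ·) ·) Nx []
      merge (join P Q ab xu yv zw) yz with _ , _ , yz₁ , yz₂ , k ← exchange yv zw yz =
        join (merge P yz₁) (merge Q yz₂) ab xu (⊕-identityˡ _) k

      -- The sums of pieces that are small, or have a small complement, in an element of B.
      -- Decomposing all of `1#` makes orthosupplements available as the sum of the other two
      -- entries.
      Hull : Pred Carrier (c ⊔ ℓ)
      Hull x = ∃₂ (Part 1# x)

      merge₁ : Hull x → x ⊕ y ↦ 1# → Part 1# x 0# y
      merge₁ (_ , _ , R) xy with _ , xp , hq ← total R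
        with _ , pq , xk ← assocʳ xp hq
        with refl ← cancel xy xk = merge R pq

      Hull-complement : Hull x → x ⊕ y ↦ 1# → Hull y
      Hull-complement Hx xy = _ , _ , swap₁₂ (swap₂₃ (merge₁ Hx xy))

      -- The third entry serves this purpose: in the decomposition with entries x, `0#` and x′, the
      -- summand y of x′ can be moved to the middle.
      joint : Hull x → Hull y → x ⊕ y ↦ z → ∃ (Part 1# x y)
      joint {z = z} Hx (_ , _ , S) xy
        with z′ , zz′ , _ ← orthosupplement z
        with _ , yz′ , xk ← assocʳ xy zz′
        with _ , 0y , R ← addPart S (merge₁ Hx xk) yz′
        with refl ← functional 0y (⊕-identityˡ _) = _ , R

      Hull-⊕ : x ⊕ y ↦ z → Hull x → Hull y → Hull z
      Hull-⊕ xy Hx Hy with w , R ← joint Hx Hy xy =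
        _ , _ , swap₁₂ (swap₂₃ (merge (swap₁₂ (swap₂₃ R)) xy))

      -- y is the orthosupplement of x ⊕ z′, so closure under sums and orthosupplements is enough.
      Hull-⊖ : x ⊕ y ↦ z → Hull x → Hull z → Hull y
      Hull-⊖ {z = z} xy Hx Hz
        with z′ , zz′ , _ ← orthosupplement z
        with (· ⟨ xz′ ⟩ ·) ⟨ ky ⟩ · ←
          shuffle 3 (λ x y z′ → (x ⊞ y) ⊞ z′ ⇒ (x ⊞ z′) ⊞ y) ((· ⟨ xy ⟩ ·) ⟨ zz′ ⟩ ·) =
        Hull-complement (Hull-⊕ xz′ Hx (Hull-complement Hz zz′)) ky

      Hull-isSub : IsSubEffectAlgebra E Hull
      Hull-isSub = record
        { 1∈   = _ , _ , leaf₁ 1∈ (⊕-identityʳ _) 1⊕0↦1 [] []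
        ; xy⇒z = Hull-⊕
        ; xz⇒y = Hull-⊖
        ; yz⇒x = λ xy → Hull-⊖ (comm xy)
        }

      -- The Riesz decomposition property of the hull

      joinˡ : Part a x y z → Part b u v w → a ⊕ b ↦ d → x ⊕ u ↦ p → ∃₂ (Part d p)
      joinˡ P Q ab xu
        with _ , xy , hz ← total P | _ , uv , kw ← total Q
        with _ , _ , hk , zw , _ ← exchange hz kw ab
        with _ , _ , _ , yv , _ ← exchange xy uv hk = _ , _ , join P Q ab xu yv zw

      Part⊆Hull : Part a x y z → Hull x
      Part⊆Hull P with b , ab , b∈ ← complement (Part-∈ P) =
        joinˡ P (leaf₃ b∈ (⊕-identityʳ _) (⊕-identityʳ _) [] []) ab (⊕-identityʳ _)

      B⊆Hull : B ⊆ Hull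
      B⊆Hull a∈ = Part⊆Hull (leaf₁ a∈ (⊕-identityʳ _) (⊕-identityʳ _) [] [])

      smallPart : a ∈ B → Small a s → s ≤ a → ∃₂ (Part a s)
      smallPart a∈ Ns (_ , sr) = _ , _ , leaf₃ a∈ (⊕-identityʳ _) (comm sr) Ns []

      Small⊆Hull : a ∈ B → Small a s → s ≤ a → Hull s
      Small⊆Hull a∈ Ns s≤a with _ , _ , P ← smallPart a∈ Ns s≤a = Part⊆Hull P

      -- If x has a small complement in a leaf, then f ⊥ x makes f small by `Small-absorb`. At a
      -- join, the same orthogonality lets homogeneity cut f along the two halves of x.
      below-isotropic : Part a x y z → x ⊥ x → f ≤ x → ∃₂ (Part a f)
      below-isotropic (leaf₁ a∈ yz xs Ny Nz) x⊥x f≤x =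
        smallPart a∈ (Small-absorb (Small-⊕ Ny Nz yz) [] xs (⊕-identityʳ _) f≤a (⊥-antitoneˡ f≤x x⊥x)) f≤a
        where f≤a = ≤-trans f≤x (_ , xs)
      below-isotropic (leaf₂ a∈ xz ys Nx Nz) x⊥x f≤x =
        smallPart a∈ (Small-down Nx x≤a f≤x) (≤-trans f≤x x≤a)
        where x≤a = ≤-trans (_ , xz) (_ , comm ys)
      below-isotropic (leaf₃ a∈ xy zs Nx Ny) x⊥x f≤x =
        smallPart a∈ (Small-down Nx x≤a f≤x) (≤-trans f≤x x≤a)
        where x≤a = ≤-trans (_ , xy) (_ , comm zs)
      below-isotropic (join P Q ab xu _ _) x⊥x f≤x@(_ , fr)
        with matrix f₁f₂ _ f₁≤x f₂≤u ← split (⊥-antitoneˡ f≤x x⊥x) fr xu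
        with _ , _ , P′ ← below-isotropic P (⊥-antitone (_ , xu) (_ , xu) x⊥x) (_ , f₁≤x)
        with _ , _ , Q′ ← below-isotropic Q (⊥-antitone (_ , comm xu) (_ , comm xu) x⊥x) (_ , f₂≤u) =
        joinˡ P′ Q′ ab f₁f₂

      data HullSplitting (u v w : Carrier) : Set (c ⊔ ℓ) where
        splitting : ∀ {u₁ u₂} → u₁ ⊕ u₂ ↦ u → u₁ ≤ v → u₂ ≤ w →
                    Hull u₁ → Hull u₂ → HullSplitting u v w

      -- Symmetric in u and its complement q, so that all kinds of leaf can be treated together.
      OneSmall : Carrier → Carrier → Carrier → Set (c ⊔ ℓ)
      OneSmall a u q = Small a u ⊎ Small a q

      OneSmall-split : OneSmall a u q → u ⊕ q ↦ d → d ≤ a → x ⊕ y ↦ d → Matrix u q x y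
      OneSmall-split (inj₁ Nu) uq d≤a xy = Small-split Nu uq d≤a xy
      OneSmall-split (inj₂ Nq) uq d≤a xy
        with matrix q₁q₂ u₁u₂ q₁u₁ q₂u₂ ← Small-split Nq (comm uq) d≤a xy =
        matrix u₁u₂ q₁q₂ (comm q₁u₁) (comm q₂u₂)

      OneSmall-down : OneSmall a u q → u ⊕ q ↦ a → x ≤ u → y ≤ q → OneSmall a x y
      OneSmall-down (inj₁ Nu) uq x≤u y≤q = inj₁ (Small-down Nu (_ , uq) x≤u)
      OneSmall-down (inj₂ Nq) uq x≤u y≤q = inj₂ (Small-down Nq (_ , comm uq) y≤q)

      OneSmall⊆Hull : a ∈ B → OneSmall a u q → u ⊕ q ↦ d → d ≤ a → Hull d → Hull u
      OneSmall⊆Hull a∈ (inj₁ Nu) uq d≤a Hd = Small⊆Hull a∈ Nu (≤-trans (_ , uq) d≤a)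
      OneSmall⊆Hull a∈ (inj₂ Nq) uq d≤a Hd =
        Hull-⊖ (comm uq) (Small⊆Hull a∈ Nq (≤-trans (_ , comm uq) d≤a)) Hd

      -- Restricting the joint decomposition 1 = v ⊕ w ⊕ z to a splits u into
      -- u₁ ≤ v, u₂ ≤ w and u₃ ≤ z; as u₃ is also below t = v ⊕ w, homogeneity
      -- splits it between what remains of v and w.
      riesz-leaf : a ∈ B → OneSmall a u q → u ⊕ q ↦ a → Hull v → Hull w → v ⊕ w ↦ t → u ≤ t →
                   HullSplitting u v w
      riesz-leaf a∈ Su uq Hv Hw vw u≤t@(_ , ur)
        with z , R ← joint Hv Hw vw
        with _ , vw′ , tz ← total R
        with refl ← functional vw vw′
        with b , ab , b∈ ← complement a∈
        with cut P Q v₁v₂ w₁w₂ z₁z₂ ← restrict R a∈ b∈ ab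
        with h , v₁w₁ , hz₁ ← total P
        with h≤a ← (_ , hz₁)
        with matrix u′u₃ q′q₃ u′q′ u₃q₃ ← OneSmall-split Su uq ≤-refl hz₁
        with matrix u₁u₂ q₁q₂ u₁q₁ u₂q₂ ←
          OneSmall-split (OneSmall-down Su uq (_ , u′u₃) (_ , q′q₃)) u′q′ h≤a v₁w₁
        with Hu₁ ← OneSmall⊆Hull a∈
          (OneSmall-down Su uq (≤-trans (_ , u₁u₂) (_ , u′u₃)) (≤-trans (_ , q₁q₂) (_ , q′q₃)))
          u₁q₁ (≤-trans (_ , v₁w₁) h≤a) (Part⊆Hull P)
        with Hu₂ ← OneSmall⊆Hull a∈
          (OneSmall-down Su uq (≤-trans (_ , comm u₁u₂) (_ , u′u₃)) (≤-trans (_ , comm q₁q₂) (_ , q′q₃)))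
          u₂q₂ (≤-trans (_ , comm v₁w₁) h≤a) (Part⊆Hull (swap₁₂ P))
        with _ , _ , R₃ ← OneSmall⊆Hull a∈ (OneSmall-down Su uq (_ , comm u′u₃) (_ , comm q′q₃))
          u₃q₃ (_ , comm hz₁) (Part⊆Hull (swap₁₂ (swap₂₃ P)))
        with _ , _ , u₁m₁ ← assocʳ u₁q₁ v₁v₂ | _ , _ , u₂m₂ ← assocʳ u₂q₂ w₁w₂
        with _ , _ , u₁u₂′ , m₁m₂ , u′k ← exchange u₁m₁ u₂m₂ vw
        with refl ← functional u₁u₂ u₁u₂′
        with _ , u₃r , u′k′ ← assocʳ u′u₃ ur
        with refl ← cancel u′k u′k′
        with u₃≤t ← ≤-trans (_ , comm u′u₃) u≤t
        with t⊥u₃ ← ⊥-antitone ≤-refl (≤-trans (_ , u₃q₃) (_ , z₁z₂)) (_ , tz)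
        with matrix t₁t₂ _ t₁m₁ t₂m₂ ←
          split (⊥-sym (⊥-antitoneˡ (_ , comm u′k) t⊥u₃)) u₃r m₁m₂
        -- Being below both t and z, u₃ is isotropic; by `below-isotropic` this puts the pieces t₁
        -- and t₂ chosen by homogeneity into the hull.
        with u₃⊥u₃ ← ⊥-antitoneˡ u₃≤t t⊥u₃
        with _ , u₁t₁ , s₁ ← assocˡ t₁m₁ u₁m₁ | _ , u₂t₂ , s₂ ← assocˡ t₂m₂ u₂m₂ =
        splitting (interchange u₁u₂ t₁t₂ u′u₃ u₁t₁ u₂t₂) (_ , s₁) (_ , s₂)
          (Hull-⊕ u₁t₁ Hu₁ (below-isotropic R₃ u₃⊥u₃ (_ , t₁t₂)))
          (Hull-⊕ u₂t₂ Hu₂ (below-isotropic R₃ u₃⊥u₃ (_ , comm t₁t₂)))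

      riesz-Hull : Part a u p q → Hull v → Hull w → v ⊕ w ↦ t → u ≤ t → HullSplitting u v w
      riesz-Hull (leaf₁ a∈ pq us Np Nq) = riesz-leaf a∈ (inj₂ (Small-⊕ Np Nq pq)) us
      riesz-Hull (leaf₂ a∈ uq ps Nu Nq) with _ , pu , hq ← assocˡ uq ps
        with _ , pq , uk ← assocʳ (comm pu) hq = riesz-leaf a∈ (inj₁ Nu) uk
      riesz-Hull (leaf₃ a∈ up qs Nu Np) with _ , pq , uk ← assocʳ up (comm qs) =
        riesz-leaf a∈ (inj₁ Nu) uk
      riesz-Hull (join P Q _ xy _ _) Hv Hw vw (_ , ur)
        with _ , yr , xk ← assocʳ xy ur
        -- After x has been split, y is split within what x leaves of v and w; these remainders are
        -- again in the hull.
        with splitting x₁x₂ (_ , x₁v′) (_ , x₂w′) Hx₁ Hx₂ ← riesz-Hull P Hv Hw vw (_ , xk)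
        with _ , _ , x₁x₂′ , v′w′ , xk′ ← exchange x₁v′ x₂w′ vw
        with refl ← functional x₁x₂ x₁x₂′
        with refl ← cancel xk xk′
        with splitting y₁y₂ (_ , y₁v″) (_ , y₂w″) Hy₁ Hy₂ ←
          riesz-Hull Q (Hull-⊖ x₁v′ Hx₁ Hv) (Hull-⊖ x₂w′ Hx₂ Hw) v′w′ (_ , yr)
        with _ , x₁y₁ , s₁ ← assocˡ y₁v″ x₁v′ | _ , x₂y₂ , s₂ ← assocˡ y₂w″ x₂w′ =
        splitting (interchange x₁x₂ y₁y₂ xy x₁y₁ x₂y₂) (_ , s₁) (_ , s₂)
          (Hull-⊕ x₁y₁ Hx₁ Hy₁) (Hull-⊕ x₂y₂ Hx₂ Hy₂)

  -- From maximal lower bounds to a lattice order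

  ≤-antisym : x ≤ y → y ≤ x → x ≡ y
  ≤-antisym (_ , xp) (_ , yq)
    with _ , pq , xr ← assocʳ xp yq
    with refl ← cancel xr (⊕-identityʳ _)
    with refl ← 0-minimal pq = functional (⊕-identityʳ _) xp

  ′-antitone : ∀ {x′ y′} → x ⊕ x′ ↦ 1# → y ⊕ y′ ↦ 1# → x ≤ y → y′ ≤ x′
  ′-antitone xx′ yy′ (_ , xd)
    with _ , dy′ , xe ← assocʳ xd yy′
    with refl ← cancel xx′ xe = _ , comm dy′

  IsInfimum : Carrier → Carrier → Carrier → Set (c ⊔ ℓ)
  IsInfimum x y g = g ≤ x × g ≤ y × (∀ w → w ≤ x → w ≤ y → w ≤ g)

  infima⇒lattice : (∀ x y → ∃ (IsInfimum x y)) → IsLatticeOrdered E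
  infima⇒lattice inf = (λ x y → ((x ′) ∧ (y ′)) ′) , _∧_ , record
    { isPartialOrder = record
      { isPreorder = record
        { isEquivalence = isEquivalence
        ; reflexive     = λ { refl → ≤-refl }
        ; trans         = ≤-trans
        }
      ; antisym = ≤-antisym
      }
    ; supremum = λ x y → let g≤x′ , g≤y′ , greatest = proj₂ (inf (x ′) (y ′)) in
        ′-antitone (complement _) (comm (complement x)) g≤x′ ,
        ′-antitone (complement _) (comm (complement y)) g≤y′ ,
        λ z x≤z y≤z → ′-antitone (comm (complement z)) (complement _)
          (greatest _ (′-antitone (complement x) (complement z) x≤z)
                      (′-antitone (complement y) (complement z) y≤z))
    ; infimum = λ x y → proj₂ (inf x y)
    }
    where
    _∧_ : Carrier → Carrier → Carrier
    x ∧ y = proj₁ (inf x y)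
    complement : ∀ x → x ⊕ x ′ ↦ 1#
    complement x = proj₁ (proj₂ (orthosupplement x))

  riesz-matrix : RieszDecomposition E → ∀ {u r v w t} →
                 u ⊕ r ↦ t → v ⊕ w ↦ t → Matrix u r v w
  riesz-matrix riesz ur vw with _ , _ , (_ , u₁r₁) , (_ , u₂r₂) , u₁u₂ ← riesz vw (_ , ur) =
    matrix u₁u₂ (remainders u₁u₂ u₁r₁ u₂r₂ ur vw) u₁r₁ u₂r₂

  -- Write w = i ⊕ k and g = i ⊕ j with k ≤ p. Cancelling i in y gives k ≤ j ⊕ q; the part of k
  -- below q is also below p and vanishes, so k ≤ j and w ≤ g.
  disjoint-remainders⇒infimum : RieszDecomposition E → ∀ {g p q} → g ⊕ p ↦ x → g ⊕ q ↦ y →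
                                (∀ {h} → h ≤ p → h ≤ q → h ≡ 0#) → IsInfimum x y g
  disjoint-remainders⇒infimum {x} {y} riesz {g} gp gq disjoint = (_ , gp) , (_ , gq) , greatest
    where
    greatest : ∀ w → w ≤ x → w ≤ y → w ≤ g
    greatest w (_ , wx) (_ , wy)
      with matrix ik _ ij kl ← riesz-matrix riesz wx gp
      with _ , jq , iv ← assocʳ ij gq | _ , kr , iv′ ← assocʳ ik wy
      with refl ← cancel iv iv′
      with matrix k₁k₂ _ k₁j k₂q ← riesz-matrix riesz kr jq
      with refl ← disjoint (≤-trans (_ , comm k₁k₂) (_ , kl)) (_ , k₂q)
      with refl ← functional k₁k₂ (⊕-identityʳ _)
      with _ , ik′ , g′ ← assocˡ k₁j ij
      with refl ← functional ik ik′ = _ , g′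

  LowerBound : Carrier → Carrier → Carrier → Set (c ⊔ ℓ)
  LowerBound x y g = g ≤ x × g ≤ y

  MaximalLowerBound : Carrier → Carrier → Carrier → Set (c ⊔ ℓ)
  MaximalLowerBound x y m =
    LowerBound x y m × (∀ {h k} → m ⊕ h ↦ k → LowerBound x y k → h ≡ 0#)

  orthogonal-meets⇒infima : RieszDecomposition E →
                            (∀ x y → x ⊥ y → ∃ (MaximalLowerBound x y)) →
                            ∀ x y → ∃ (IsInfimum x y)
  orthogonal-meets⇒infima riesz meet x y
    with _ , xx′ , _ ← orthosupplement x | _ , yy′ , _ ← orthosupplement y
    with matrix ab cd ac bd ← riesz-matrix riesz xx′ yy′
    with (· ⟨ bc ⟩ ·) ⟨ _ ⟩ _ ←
      shuffle 4 (λ a b c d → (a ⊞ b) ⊞ (c ⊞ d) ⇒ (b ⊞ c) ⊞ (a ⊞ d))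
        ((· ⟨ ab ⟩ ·) ⟨ xx′ ⟩ (· ⟨ cd ⟩ ·))
    with m , ((_ , mp) , (_ , mq)) , maximal ← meet _ _ (_ , bc)
    with _ , am , gp ← assocˡ mp ab | _ , am′ , gq ← assocˡ mq ac
    with refl ← functional am am′ =
    -- A common lower bound of the remainders could be added to m, so maximality makes it zero.
    _ , disjoint-remainders⇒infimum riesz gp gq λ (_ , he) (_ , hf) →
      let _ , mh , kb = assocˡ he mp
          _ , mh′ , kc = assocˡ hf mq
      in maximal mh ((_ , kb) , (_ , subst (_⊕ _ ↦ _) (functional mh′ mh) kc))

  -- Isotropic elements and blocks

  module Classical (em : ∀ {a} → ExcludedMiddle a) where

    riesz⇒Refining : {P : Pred Carrier i} (isSub : IsSubEffectAlgebra E P) →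
                     RieszDecomposition (subEffectAlgebra E P isSub) → Refining P
    riesz⇒Refining isSub riesz {u} {r} {v} {w} {t} ur vw u∈ r∈ v∈ w∈
      with (_ , [ u₁∈ ]) , (_ , [ u₂∈ ]) , ((_ , [ r₁∈ ]) , u₁r₁) , ((_ , [ r₂∈ ]) , u₂r₂) , u₁u₂ ←
        riesz {u , [ u∈ ]} {v , [ v∈ ]} {w , [ w∈ ]}
              {t , [ IsSubEffectAlgebra.xy⇒z isSub ur u∈ r∈ ]} vw ((r , [ r∈ ]) , ur) =
      matrix u₁u₂ (remainders u₁u₂ u₁r₁ u₂r₂ ur vw) u₁r₁ u₂r₂
        -- Irrelevant membership proofs are recovered by deciding membership with excluded middle.
        (recompute em u₁∈) (recompute em u₂∈) (recompute em r₁∈) (recompute em r₂∈)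

    isotropic∈block : Homogeneous E → {B : Pred Carrier (c ⊔ ℓ)} → IsBlock E B →
                      b ∈ B → z ≤ b → z ⊥ b → z ∈ B
    isotropic∈block homogeneous {B} block b∈ z≤b z⊥b =
      maximal Hull Hull-isSub (λ {u} {v₁} {v₂} {v} → riesz-Hull′ {u} {v₁} {v₂} {v}) B⊆Hull
        (Small⊆Hull b∈ (z⊥b ∷⟨ ⊕-identityʳ _ ⟩ []) z≤b)
      where
      open IsBlock block
      open Extension homogeneous isSub (riesz⇒Refining isSub λ {u} {v₁} {v₂} {v} → riesz {u} {v₁} {v₂} {v})
      riesz-Hull′ : RieszDecomposition (subEffectAlgebra E Hull Hull-isSub)
      riesz-Hull′ {_ , [ Hu ]} {_ , [ Hv ]} {_ , [ Hw ]} vw (_ , ur)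
        with _ , _ , P ← recompute em Hu
        with splitting u₁u₂ (_ , u₁m₁) (_ , u₂m₂) Hu₁ Hu₂ ←
          riesz-Hull P (recompute em Hv) (recompute em Hw) vw (_ , ur) =
        (_ , [ Hu₁ ]) , (_ , [ Hu₂ ]) , ((_ , [ Hull-⊖ u₁m₁ Hu₁ Hv ]) , u₁m₁) ,
        ((_ , [ Hull-⊖ u₂m₂ Hu₂ Hw ]) , u₂m₂) , u₁u₂

  -- Maximal lower bounds from Zorn's lemma and orthocompleteness

  module _ {H : Set i} where

    Sum-cong : ∀ {f g : H → Carrier} {K} → All (λ κ → f κ ≡ g κ) K → Sum E f K s → Sum E g K s
    Sum-cong []         []      = []
    Sum-cong (eq ∷ eqs) (k ∷ s) = subst (λ x → x ⊕ _ ↦ _) eq k ∷ Sum-cong eqs s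

    Sum-0 : ∀ (K : List H) → Sum E (λ _ → 0#) K 0#
    Sum-0 []      = []
    Sum-0 (_ ∷ K) = ⊕-identityʳ 0# ∷ Sum-0 K

    Sum-functional : ∀ {f : H → Carrier} {K} → Sum E f K s → Sum E f K t → s ≡ t
    Sum-functional []      []      = refl
    Sum-functional (k ∷ s) (l ∷ t) with refl ← Sum-functional s t = functional k l

  module Existence (em : ∀ {a} → ExcludedMiddle a)
                   (zorn : ∀ {a r₁ r₂} → ZornsLemma a r₁ r₂)
                   (orthocomplete : Orthocomplete E) (a b : Carrier) where

    -- The pairs (d , n) index the copies of d; a subset S of them is the
    -- system with 0# in place of the missing entries.
    Index : Set (c ⊔ ℓ)
    Index = Lift ℓ (Carrier × ℕ)

    copy : Carrier → ℕ → Index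
    copy d n = lift (d , n)

    entry : Index → Bool → Carrier
    entry κ present = if present then proj₁ (lower κ) else 0#

    system : (Index → Bool) → Index → Carrier
    system S κ = entry κ (S κ)

    Bounded : (Index → Bool) → Set (c ⊔ ℓ)
    Bounded S = ∀ K → Unique K → ∃ λ s → Sum E (system S) K s × LowerBound a b s

    infix 4 _⊑_
    _⊑_ : (S U : ∃ Bounded) → Set (c ⊔ ℓ)
    S ⊑ U = ∀ κ → proj₁ S κ ≡ true → proj₁ U κ ≡ true

    systems : Poset (c ⊔ ℓ) (c ⊔ ℓ) (c ⊔ ℓ)
    systems = record
      { Carrier = ∃ Bounded
      -- Mutual inclusion as equality makes antisymmetry immediate, whatever the proofs of `Bounded`
      -- are.
      ; _≈_     = λ S U → S ⊑ U × U ⊑ S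
      ; _≤_     = _⊑_
      ; isPartialOrder = record
        { isPreorder = record
          { isEquivalence = record
            { refl  = (λ _ → id) , (λ _ → id)
            ; sym   = λ (p , q) → q , p
            ; trans = λ (p , q) (p′ , q′) → (λ κ → p′ κ ∘ p κ) , (λ κ → q κ ∘ q′ κ)
            }
          ; reflexive = proj₁
          ; trans     = λ p q κ → q κ ∘ p κ
          }
        ; antisym = _,_
        }
      }

    module Union (C : Pred (∃ Bounded) (c ⊔ ℓ))
                 (chain : ∀ {S U} → S ∈ C → U ∈ C → S ⊑ U ⊎ U ⊑ S) where

      Covered : Index → Set (c ⊔ ℓ)
      Covered κ = ∃ λ S → S ∈ C × proj₁ S κ ≡ true

      union : Index → Bool
      union κ = does (em {P = Covered κ})

      member⊑union : ∀ {S} → S ∈ C → ∀ κ → proj₁ S κ ≡ true → union κ ≡ true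
      member⊑union S∈C κ Sκ = dec-true em (_ , S∈C , Sκ)

      union-false : ∀ {κ} → union κ ≡ false → union κ ≢ true
      union-false eq eq′ = case trans (sym eq) eq′ of λ ()

      -- By the chain condition one member takes care of finitely many indices. The second
      -- alternative is there for an empty chain, which offers no member to choose.
      finite-cover : ∀ K → (∃ λ S → S ∈ C × All (λ κ → union κ ≡ true → proj₁ S κ ≡ true) K) ⊎
                           All (λ κ → union κ ≡ false) K
      finite-cover []      = inj₂ []
      finite-cover (κ ∷ K) with finite-cover K | em {P = Covered κ}
      ... | inj₁ (S , S∈C , S⊇K) | no ¬covered =
        inj₁ (S , S∈C , (λ eq → contradiction eq (union-false (dec-false em ¬covered))) ∷ S⊇K)
      ... | inj₂ none            | no ¬covered = inj₂ (dec-false em ¬covered ∷ none)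
      ... | inj₂ none            | yes (S , S∈C , Sκ) =
        inj₁ (S , S∈C , (λ _ → Sκ) ∷ All.map (λ eq eq′ → contradiction eq′ (union-false eq)) none)
      ... | inj₁ (U , U∈C , U⊇K) | yes (S , S∈C , Sκ) with chain S∈C U∈C
      ...   | inj₁ S⊑U = inj₁ (U , U∈C , (λ _ → S⊑U κ Sκ) ∷ U⊇K)
      ...   | inj₂ U⊑S = inj₁ (S , S∈C , (λ _ → Sκ) ∷ All.map (λ {κ} eq⇒ eq → U⊑S κ (eq⇒ eq)) U⊇K)

      union-bounded : Bounded union
      union-bounded K uK with finite-cover K
      ... | inj₂ none =
        0# , Sum-cong (All.map (λ {κ} eq → sym (cong (entry κ) eq)) none) (Sum-0 K) ,
        (_ , ⊕-identityˡ _) , (_ , ⊕-identityˡ _)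
      ... | inj₁ (S , S∈C , S⊇K) with s , sum , bound ← proj₂ S K uK =
        s , Sum-cong (All.map (λ {κ} eq⇒ → cong (entry κ)
                       (⇔→≡ (mk⇔ (member⊑union S∈C κ) eq⇒))) S⊇K) sum , bound

    maximal-system : ∃ λ S → ∀ {U} → S ⊑ U → U ⊑ S
    maximal-system
      with S , maximal ← zorn systems (λ C chain → let open Union C chain in
                           (union , union-bounded) , λ {S} S∈C → member⊑union {S} S∈C) =
      S , λ {U} S⊑U → proj₁ (maximal {U} S⊑U)

    module Adjoin {S : Index → Bool} {κ₀ : Index} (κ₀∉S : S κ₀ ≡ false) where

      d₀ = proj₁ (lower κ₀)

      adjoin : Index → Bool
      adjoin κ = S κ ∨ does (em {P = κ ≡ κ₀})

      adjoin-new : adjoin κ₀ ≡ true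
      adjoin-new = trans (cong (S κ₀ ∨_) (dec-true em refl)) (∨-zeroʳ _)

      adjoin-old : ∀ {κ} → κ ≢ κ₀ → adjoin κ ≡ S κ
      adjoin-old κ≢κ₀ = trans (cong (S _ ∨_) (dec-false em κ≢κ₀)) (∨-identityʳ _)

      S⊑adjoin : ∀ κ → S κ ≡ true → adjoin κ ≡ true
      S⊑adjoin κ eq = cong (_∨ _) eq

      Sum-old : ∀ {K} → All (_≢ κ₀) K → Sum E (system S) K s → Sum E (system adjoin) K s
      Sum-old = Sum-cong ∘ All.map λ {κ} κ≢κ₀ → cong (entry κ) (sym (adjoin-old κ≢κ₀))

      -- The index κ₀ contributed `0#` before, and uniqueness of K ensures that d₀ is added only
      -- once.
      Sum-new : ∀ {K} → κ₀ List.∈ K → Unique K → Sum E (system S) K s → s ⊕ d₀ ↦ t →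
                Sum E (system adjoin) K t
      Sum-new (here refl) (κ₀∉K ∷ _) (k ∷ sum) st
        rewrite κ₀∉S with refl ← functional k (⊕-identityˡ _) =
        subst (λ x → x ⊕ _ ↦ _) (sym (cong (entry κ₀) adjoin-new)) (comm st) ∷
          Sum-old (All.map (λ neq eq → neq (sym eq)) κ₀∉K) sum
      Sum-new (there {x = κ} κ₀∈K) (κ∉K ∷ uK) (k ∷ sum) st
        with _ , sv , xv ← assocʳ k st =
        subst (λ x → x ⊕ _ ↦ _)
          (cong (entry κ) (sym (adjoin-old (All.lookup κ∉K κ₀∈K)))) xv ∷
          Sum-new κ₀∈K uK sum sv

    abstract
      maximalLowerBound : ∃ (MaximalLowerBound a b)
      maximalLowerBound
        with S@(f , f-bounded) , maximal ← maximal-system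
        with m , upper , least ← orthocomplete (system f)
               (λ K uK → let s , sum , _ = f-bounded K uK in s , sum) =
        m , (least (proj₁ ∘ bound) , least (proj₂ ∘ bound)) , h≡0
        where
        bound : ∀ {s} → FiniteSum E (system f) s → LowerBound a b s
        bound (K , uK , sum) with _ , sum′ , s≤ ← f-bounded K uK
          with refl ← Sum-functional sum sum′ = s≤

        module _ {h k} (mh : m ⊕ h ↦ k) (k≤ : LowerBound a b k) where

          ≤k : ∀ {s} → s ≤ k → LowerBound a b s
          ≤k s≤k = ≤-trans s≤k (proj₁ k≤) , ≤-trans s≤k (proj₂ k≤)

          -- With a further copy of h adjoined, finite sums stay below m ⊕ h = k, hence below a and
          -- b, so maximality puts the copy into the system.
          copies∈S : ∀ n → f (copy h n) ≡ true
          copies∈S n with f κ in eq where κ = copy h n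
          ... | true  = refl
          ... | false = trans (sym eq) (maximal {_ , adjoin-bounded} S⊑adjoin κ₀ adjoin-new)
            where
            κ₀ = copy h n
            open Adjoin {f} {κ₀} eq
            adjoin-bounded : Bounded adjoin
            adjoin-bounded K uK
              with s , sum , _ ← f-bounded K uK
              with _ , sd ← upper (K , uK , sum)
              with (· ⟨ sh ⟩ ·) ⟨ td ⟩ · ←
                shuffle 3 (λ s d h → (s ⊞ d) ⊞ h ⇒ (s ⊞ h) ⊞ d) ((· ⟨ sd ⟩ ·) ⟨ mh ⟩ ·)
              with any? (λ κ → em {P = κ₀ ≡ κ}) K
            ... | yes κ₀∈K = _ , Sum-new κ₀∈K uK sum sh , ≤k (_ , td)
            ... | no  κ₀∉K = _ , Sum-old (All.map (λ neq eq → neq (sym eq)) (All.¬Any⇒All¬ K κ₀∉K)) sum ,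
                             ≤k (≤-trans (_ , sd) (_ , mh))

          fresh : ∀ K → ∃ λ n → All (copy h n ≢_) K
          fresh K = suc bound′ , All.map
            (λ le eq → 1+n≰n (subst (λ κ → proj₂ (lower κ) ≤ℕ bound′) (sym eq) le))
            (All.map⁻ (xs≤max 0 (map (proj₂ ∘ lower) K)))
            where bound′ = max 0 (map (proj₂ ∘ lower) K)

          add-copy : ∀ {s} → FiniteSum E (system f) s → ∃ λ t → h ⊕ s ↦ t × t ≤ m
          add-copy (K , uK , sum)
            with n , copy∉K ← fresh K
            with t , k ∷ sum′ , _ ← f-bounded (copy h n ∷ K) (copy∉K ∷ uK)
            with refl ← Sum-functional sum sum′ =
            t , subst (λ x → x ⊕ _ ↦ t) (cong (entry (copy h n)) (copies∈S n)) k ,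
            upper (_ , copy∉K ∷ uK , k ∷ sum)

          -- Adding one more copy of h to a finite sum leaves it below m, so
          -- m ≤ m ⊖ h.
          h≡0 : h ≡ 0#
          h≡0
            -- The empty sum yields h ≤ m, so that m′ = m ⊖ h exists.
            with _ , h0 , t≤m ← add-copy ([] , [] , [])
            with m′ , hm′ ← ≤-trans (_ , h0) t≤m
            with _ , me ← least {m′} (λ sum → case add-copy sum of λ where
                   (_ , hs , _ , te) → case assocʳ hs te of λ where
                     (_ , se , hv) → _ , subst (_ ⊕ _ ↦_) (cancel hv hm′) se)
            with _ , hm , ue ← assocˡ me hm′
            with _ , he , mv ← assocʳ (comm hm) ue
            with refl ← cancel mv (⊕-identityʳ m) = 0-minimal he

proposition3p15 : (∀ {a} → ExcludedMiddle a) →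
    (∀ {a r₁ r₂} → ZornsLemma a r₁ r₂) →
    ∀ {c ℓ} (E : EffectAlgebra c ℓ) → Orthocomplete E → Homogeneous E →
    (B : Pred (EffectAlgebra.Carrier E) (c ⊔ ℓ)) (block : IsBlock E B) →
    IsLatticeOrdered (subEffectAlgebra E B (IsBlock.isSub block))
proposition3p15 em zorn E orthocomplete homogeneous B block =
  F.infima⇒lattice (F.orthogonal-meets⇒infima (λ {u} {v₁} {v₂} {v} → riesz {u} {v₁} {v₂} {v}) orthogonal-meet)
  where
  open IsBlock block
  F = subEffectAlgebra E B isSub
  module E where
    open EffectAlgebra E public
    open Theory E public
  module F where
    open EffectAlgebra F public
    open Theory F public

  value-injective : {x y : F.Carrier} → value x ≡ value y → x ≡ y
  value-injective {_ , _} {_ , _} refl = refl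

  orthogonal-meet : ∀ x y → x F.⊥ y → ∃ (F.MaximalLowerBound x y)
  orthogonal-meet x@(_ , [ x∈ ]) y@(_ , [ y∈ ]) (_ , xy)
    with m , ((p , mp) , (q , mq)) , maximal ←
      E.Existence.maximalLowerBound em zorn orthocomplete (value x) (value y) =
    (m , [ m∈ ]) ,
    (((p , [ xz⇒y mp m∈ x∈ ]) , mp) , ((q , [ xz⇒y mq m∈ y∈ ]) , mq)) ,
    -- Sums and lower bounds in B are also such in E, so maximality carries over.
    λ mh ((_ , kx) , (_ , ky)) → value-injective (maximal mh ((_ , kx) , (_ , ky)))
    where
    open IsSubEffectAlgebra isSub
    m∈ = E.Classical.isotropic∈block em homogeneous block (recompute em x∈) (_ , mp)
           (E.⊥-antitoneˡ (_ , mq) (E.⊥-sym (_ , xy)))
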